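{- The hereditary class property $\Sigma=$ "weakly sparse" — the set of hereditary classes $\mathscr C$ for which there is an integer $t$ such that no graph in $\mathscr C$ contains $K_{t,t}$ as a subgraph — is a decomposition horizon, i.e. $\Sigma^\ast=\Sigma$.
   Context: Graphs are finite and simple; $K_{t,t}$ is the complete bipartite graph with both parts of size $t$. A hereditary class is a class closed under isomorphism and induced subgraphs; a hereditary class property is a set $\Pi$ of hereditary classes closed under passing to hereditary subclasses. For non-decreasing $f:\mathbb N\to\mathbb N$ and positive integer $p$, $\mathscr C$ has an $f$-bounded $\Pi$-decomposition with parameter $p$ if there is $\mathscr D_p\in\Pi$ such that every $G\in\mathscr C$ has a partition $V_1,\dots,V_N$ of $V(G)$ with $N\le f(|G|)$ and $G[V_{i_1}\cup\dots\cup V_{i_p}]\in\mathscr D_p$ for all $i_1,\dots,i_p\in[N]$. $\Pi^\ast$ is the set of hereditary classes that, for every positive integer $p$, have such a decomposition for some non-decreasing $f$ with $f(n)=n^{o(1)}$. $\Pi$ is a decomposition horizon if $\Pi^\ast=\Pi$. -}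

module Defs where

open import Data.Bool.Base using (Bool; false; T; _xor_)
open import Data.Bool.Properties using (xor-same; xor-comm)
open import Data.Fin.Base using (Fin; toℕ)
open import Data.Fin.Subset using (Subset; _∈_; _∩_; ⋃; Empty; Nonempty)
open import Data.Fin.Subset.Properties using (_∈?_)
open import Data.List.Base using (List; allFin; filter; length; lookup; tabulate)
open import Data.Nat.Base using (ℕ; NonZero; _+_; _^_; _≤_; _<ᵇ_)
open import Data.Product.Base using (Σ-syntax; ∃-syntax; _×_; _,_)
open import Function.Bundles using (_↔_; _⇔_; Inverse)
open import Function.Definitions using (Injective)
open import Level using (Level; _⊔_; 0ℓ) renaming (suc to lsuc)
open import Relation.Binary.Core using (_Preserves_⟶_)
open import Relation.Binary.PropositionalEquality using (_≡_; _≢_)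
open import Relation.Nullary.Negation using (¬_)

record Graph : Set where
  field
    order  : ℕ
    adj    : Fin order → Fin order → Bool
    irrefl : ∀ v → adj v v ≡ false
    sym    : ∀ u v → adj u v ≡ adj v u

open Graph public

Adj : (G : Graph) → Fin (order G) → Fin (order G) → Set
Adj G u v = T (adj G u v)

_≅_ : Graph → Graph → Set
G ≅ H = Σ[ φ ∈ Fin (order G) ↔ Fin (order H) ]
          (∀ u v → adj G u v ≡ adj H (Inverse.to φ u) (Inverse.to φ v))

elements : ∀ {n} → Subset n → List (Fin n)
elements {n} S = filter (_∈? S) (allFin n)

-- The vertices of S, in increasing order, are renumbered 0, 1, ….
_[_] : (G : Graph) → Subset (order G) → Graph
G [ S ] = record
  { order  = length (elements S)
  ; adj    = λ i j → adj G (lookup (elements S) i) (lookup (elements S) j)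
  ; irrefl = λ i → irrefl G (lookup (elements S) i)
  ; sym    = λ i j → sym G (lookup (elements S) i) (lookup (elements S) j)
  }

-- Containment as a (not necessarily induced) subgraph, up to isomorphism.
_⊑_ : Graph → Graph → Set
H ⊑ G = Σ[ f ∈ (Fin (order H) → Fin (order G)) ]
          Injective _≡_ _≡_ f × (∀ u v → Adj H u v → Adj G (f u) (f v))

-- The first s vertices form one part, the last t the other.
K : ℕ → ℕ → Graph
K s t = record
  { order  = s + t
  ; adj    = λ u v → left u xor left v
  ; irrefl = λ v → xor-same (left v)
  ; sym    = λ u v → xor-comm (left u) (left v)
  }
  where
  left : Fin (s + t) → Bool
  left v = toℕ v <ᵇ s

record HereditaryClass : Set₁ where
  field
    member         : Graph → Set
    iso-closed     : ∀ {G H} → G ≅ H → member G → member H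
    induced-closed : ∀ {G} (S : Subset (order G)) → member G → member (G [ S ])

infix 4 _∈ᶜ_ _⊆ᶜ_ _∈ᵖ_

_∈ᶜ_ : Graph → HereditaryClass → Set
G ∈ᶜ 𝒞 = HereditaryClass.member 𝒞 G

_⊆ᶜ_ : HereditaryClass → HereditaryClass → Set
𝒞 ⊆ᶜ 𝒟 = ∀ {G} → G ∈ᶜ 𝒞 → G ∈ᶜ 𝒟

record HereditaryClassProperty (ℓ : Level) : Set (lsuc 0ℓ ⊔ lsuc ℓ) where
  field
    holds       : HereditaryClass → Set ℓ
    down-closed : ∀ {𝒞 𝒟} → 𝒞 ⊆ᶜ 𝒟 → holds 𝒟 → holds 𝒞

_∈ᵖ_ : ∀ {ℓ} → HereditaryClass → HereditaryClassProperty ℓ → Set ℓ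
𝒞 ∈ᵖ Π = HereditaryClassProperty.holds Π 𝒞

record Partition (n N : ℕ) : Set where
  field
    part     : Fin N → Subset n
    nonempty : ∀ i → Nonempty (part i)
    disjoint : ∀ {i j} → i ≢ j → Empty (part i ∩ part j)
    cover    : ∀ v → ∃[ i ] v ∈ part i

open Partition public

⋃ᵖ : ∀ {n N p} → Partition n N → (Fin p → Fin N) → Subset n
⋃ᵖ P i = ⋃ (tabulate (λ k → part P (i k)))

HasBoundedDecomposition : ∀ {ℓ} → HereditaryClassProperty ℓ → (ℕ → ℕ) → ℕ →
                          HereditaryClass → Set (lsuc 0ℓ ⊔ ℓ)
HasBoundedDecomposition Π f p 𝒞 =
  Σ[ 𝒟 ∈ HereditaryClass ] 𝒟 ∈ᵖ Π ×
    (∀ G → G ∈ᶜ 𝒞 →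
      ∃[ N ] N ≤ f (order G) ×
        Σ[ P ∈ Partition (order G) N ]
          (∀ (i : Fin p → Fin N) → (G [ ⋃ᵖ P i ]) ∈ᶜ 𝒟))

-- f(n) = n^{o(1)}: for every k ≥ 1, n^{-1/k} ≤ f(n) ≤ n^{1/k} eventually.
-- As f(n) is a natural number, the lower bound amounts to 1 ≤ f(n) (for n ≥ 1);
-- k = 0 adds nothing.
Subpolynomial : (ℕ → ℕ) → Set
Subpolynomial f = ∀ k → ∃[ n₀ ] (∀ n → n₀ ≤ n → 1 ≤ f n × f n ^ k ≤ n)

infix 30 _*

_* : ∀ {ℓ} → HereditaryClassProperty ℓ → HereditaryClassProperty (lsuc 0ℓ ⊔ ℓ)
Π * = record
  { holds = λ 𝒞 → ∀ p → .{{_ : NonZero p}} →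
      Σ[ f ∈ (ℕ → ℕ) ]
        f Preserves _≤_ ⟶ _≤_ × Subpolynomial f × HasBoundedDecomposition Π f p 𝒞
  ; down-closed = λ 𝒞⊆𝒟 h p →
      let f , mono , sub , ℰ , ℰ∈Π , dec = h p
      in  f , mono , sub , ℰ , ℰ∈Π , λ G G∈𝒞 → dec G (𝒞⊆𝒟 G∈𝒞)
  }

IsDecompositionHorizon : ∀ {ℓ} → HereditaryClassProperty ℓ → Set (lsuc 0ℓ ⊔ ℓ)
IsDecompositionHorizon Π = ∀ 𝒞 → 𝒞 ∈ᵖ Π * ⇔ 𝒞 ∈ᵖ Π

weaklySparse : HereditaryClassProperty 0ℓ
weaklySparse = record
  { holds       = λ 𝒞 → ∃[ t ] (∀ G → G ∈ᶜ 𝒞 → ¬ (K t t ⊑ G))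
  ; down-closed = λ 𝒞⊆𝒟 (t , free) → t , λ G G∈𝒞 → free G (𝒞⊆𝒟 G∈𝒞)
  }

{-# OPTIONS --safe #-}

-- Only unions of two parts are needed for Σ* ⊆ Σ.  If K_{s,s} ⊑ G ∈ 𝒞, pass to the at most
-- 2s vertices it uses, so that the number N of parts is at most f(2s), hence N² ≤ 2s for
-- large s.  By pigeonhole each side meets some part in at least s/N vertices, so the union
-- of two parts contains K_{t,t} as soon as s > Nt, which holds once s > 2t².

module Submission where

open import Data.Bool.Base using (Bool; true; false; T; _xor_)
open import Data.Fin.Base using (Fin; zero; suc; toℕ; combine; inject≤; join; splitAt; _↑ˡ_; _↑ʳ_)
open import Data.Fin.Properties
  using (_≟_; any?; combine-injective; inject≤-injective; injective⇒≤; join-splitAt;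
         splitAt-join)
open import Data.Fin.Subset using (Subset; _∈_; ⊤; ⋃; ⁅_⁆)
open import Data.Fin.Subset.Properties using (_∈?_; ∈⊤; ∉⊥; x∈p∪q⁺; x∈p∪q⁻; x∈⁅x⁆; x∈⁅y⁆⇒x≡y)
open import Data.List.Base using (List; allFin; filter; length; lookup; tabulate)
import Data.List.Membership.Propositional as List
open import Data.List.Membership.Propositional.Properties
  using (∈-allFin; ∈-filter⁺; ∈-filter⁻; ∈-lookup)
open import Data.List.Membership.Setoid.Properties using (index-injective)
import Data.List.Relation.Unary.All as All
open import Data.List.Relation.Unary.AllPairs using (_∷_)
open import Data.List.Relation.Unary.Any using (index)
open import Data.List.Relation.Unary.Any.Properties using (lookup-index)
open import Data.List.Relation.Unary.Unique.Propositional using (Unique)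
open import Data.List.Relation.Unary.Unique.Propositional.Properties using (allFin⁺; filter⁺)
open import Data.Nat.Base using (zero; suc; _+_; _*_; _^_; _≤_; _<_; _<ᵇ_; z≤n; s≤s)
open import Data.Nat.Properties
  using (_≤?_; ≤-refl; ≤-trans; ≤-reflexive; ≰⇒>; <⇒≱; <⇒≤; m≤m+n; m≤n+m; *-mono-≤; *-monoˡ-≤;
         *-cancelˡ-≤; ^-zeroˡ; ≤-<-trans; module ≤-Reasoning)
open import Data.Nat.Tactic.RingSolver using (solve-∀)
open import Data.Product.Base using (Σ-syntax; ∃-syntax; _×_; _,_; proj₁; proj₂)
open import Data.Sum.Base as Sum using (_⊎_; inj₁; inj₂)
open import Data.Sum.Properties using (inj₁-injective; inj₂-injective)
open import Data.Vec.Base as Vec using ([]; _∷_)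
open import Function.Base using (_∘_)
open import Function.Bundles using (mk⇔)
open import Function.Definitions using (Injective)
open import Relation.Binary.PropositionalEquality as ≡
  using (_≡_; refl; cong; cong₂; subst; subst₂; trans)
open import Relation.Nullary.Decidable using (yes; no)
open import Relation.Nullary.Negation using (¬_; contradiction)

open import Defs

lookup-injective : ∀ {A : Set} {xs : List A} → Unique xs → Injective _≡_ _≡_ (lookup xs)
lookup-injective (x∉xs ∷ xs!) {zero}  {zero}  eq = refl
lookup-injective (x∉xs ∷ xs!) {zero}  {suc j} eq = contradiction eq (All.lookup x∉xs (∈-lookup j))
lookup-injective (x∉xs ∷ xs!) {suc i} {zero}  eq = contradiction (≡.sym eq) (All.lookup x∉xs (∈-lookup i))
lookup-injective (x∉xs ∷ xs!) {suc i} {suc j} eq = cong suc (lookup-injective xs! eq)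

-- If every colour class had fewer than `t` elements, sending `u` to its colour together with its
-- position in its class would inject `Fin s` into `Fin (N * t)`.
pigeonhole-many : ∀ {s N} t (c : Fin s → Fin N) → N * t < s →
  ∃[ i ] Σ[ g ∈ (Fin t → Fin s) ] Injective _≡_ _≡_ g × (∀ j → c (g j) ≡ i)
pigeonhole-many {s} {N} t c Nt<s with any? (λ i → t ≤? length (filter (λ u → c u ≟ i) (allFin s)))
... | yes (i , t≤) = i , g , g-injective , λ j →
  proj₂ (∈-filter⁻ (λ u → c u ≟ i) {xs = allFin s} (∈-lookup (inject≤ j t≤)))
  where
  g : Fin t → Fin s
  g j = lookup (filter (λ u → c u ≟ i) (allFin s)) (inject≤ j t≤)

  g-injective : Injective _≡_ _≡_ g
  g-injective eq = inject≤-injective t≤ t≤ _ _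
    (lookup-injective (filter⁺ (λ u → c u ≟ i) (allFin⁺ s)) eq)
... | no small = contradiction (injective⇒≤ rank-injective) (<⇒≱ Nt<s)
  where
  class : Fin N → List (Fin s)
  class i = filter (λ u → c u ≟ i) (allFin s)

  member : ∀ {u i} → c u ≡ i → u List.∈ class i
  member = ∈-filter⁺ (λ u → c u ≟ _) (∈-allFin _)

  position : ∀ {u i} → c u ≡ i → Fin t
  position {i = i} eq = inject≤ (index (member eq)) (<⇒≤ (≰⇒> (λ t≤ → small (i , t≤))))

  -- The colours are variables `i` and `j`, because an equation `c u ≡ c v` cannot be matched with
  -- `refl`.
  position-injective : ∀ {u v i j} (p : c u ≡ i) (q : c v ≡ j) → i ≡ j → position p ≡ position q → u ≡ v
  position-injective p q refl eq =
    index-injective (≡.setoid _) (member p) (member q) (inject≤-injective _ _ _ _ eq)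

  rank : Fin s → Fin (N * t)
  rank u = combine (c u) (position {u} refl)

  rank-injective : Injective _≡_ _≡_ rank
  rank-injective {u} {v} eq =
    let cu≡cv , same-position = combine-injective (c u) _ (c v) _ eq
    in  position-injective refl refl cu≡cv same-position

∈-⋃-tabulate⁺ : ∀ {n k} (F : Fin k → Subset n) i {x} → x ∈ F i → x ∈ ⋃ (tabulate F)
∈-⋃-tabulate⁺ F zero    x∈ = x∈p∪q⁺ (inj₁ x∈)
∈-⋃-tabulate⁺ F (suc i) x∈ = x∈p∪q⁺ {p = F zero} (inj₂ (∈-⋃-tabulate⁺ (F ∘ suc) i x∈))

∈-⋃-tabulate⁻ : ∀ {n k} (F : Fin k → Subset n) {x} → x ∈ ⋃ (tabulate F) → ∃[ i ] x ∈ F i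
∈-⋃-tabulate⁻ {k = zero}  F x∈ = contradiction x∈ ∉⊥
∈-⋃-tabulate⁻ {k = suc k} F x∈ with x∈p∪q⁻ (F zero) _ x∈
... | inj₁ x∈F₀ = zero , x∈F₀
... | inj₂ x∈⋃  = let i , x∈Fᵢ = ∈-⋃-tabulate⁻ (F ∘ suc) x∈⋃ in suc i , x∈Fᵢ

image : ∀ {m n} → (Fin m → Fin n) → Subset n
image f = ⋃ (tabulate (λ i → ⁅ f i ⁆))

∈-image : ∀ {m n} (f : Fin m → Fin n) i → f i ∈ image f
∈-image f i = ∈-⋃-tabulate⁺ (λ i → ⁅ f i ⁆) i (x∈⁅x⁆ (f i))

image-preimage : ∀ {m n} (f : Fin m → Fin n) {x} → x ∈ image f → ∃[ i ] x ≡ f i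
image-preimage f x∈ = let i , x∈⁅fi⁆ = ∈-⋃-tabulate⁻ (λ i → ⁅ f i ⁆) x∈ in i , x∈⁅y⁆⇒x≡y (f i) x∈⁅fi⁆

-- Choosing a preimage for each listed vertex is injective, as the list has no repetitions. The left
-- side is the order of the subgraph induced on the image.
∣image∣≤ : ∀ {m n} (f : Fin m → Fin n) → length (elements (image f)) ≤ m
∣image∣≤ {m} {n} f = injective⇒≤ {f = proj₁ ∘ preimage} λ {i} {j} eq →
  lookup-injective (filter⁺ (_∈? image f) (allFin⁺ n))
    (trans (proj₂ (preimage i)) (trans (cong f eq) (≡.sym (proj₂ (preimage j)))))
  where
  preimage : ∀ k → ∃[ i ] lookup (elements (image f)) k ≡ f i
  preimage k = image-preimage f (proj₂ (∈-filter⁻ (_∈? image f) {xs = allFin n} (∈-lookup k)))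

-- Each `u` goes to the position of `f u` in `elements S`; looking that position up gives back
-- `f u`, so injectivity and adjacency carry over.
⊑-induced : ∀ H G (S : Subset (order G)) ((f , _) : H ⊑ G) → (∀ u → f u ∈ S) → H ⊑ (G [ S ])
⊑-induced H G S (f , f-injective , f-adj) f∈S =
  g , g-injective , λ u v → subst₂ (Adj G) (≡.sym (lookup-g u)) (≡.sym (lookup-g v)) ∘ f-adj u v
  where
  f∈elements : ∀ u → f u List.∈ elements S
  f∈elements u = ∈-filter⁺ (_∈? S) (∈-allFin (f u)) (f∈S u)

  g : Fin (order H) → Fin (length (elements S))
  g u = index (f∈elements u)

  lookup-g : ∀ u → lookup (elements S) (g u) ≡ f u
  lookup-g u = ≡.sym (lookup-index (f∈elements u))

  g-injective : Injective _≡_ _≡_ g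
  g-injective eq = f-injective (index-injective (≡.setoid _) (f∈elements _) (f∈elements _) eq)

⊑-trans : ∀ G H J → G ⊑ H → H ⊑ J → G ⊑ J
⊑-trans _ _ _ (f , f-injective , f-adj) (g , g-injective , g-adj) =
  g ∘ f , f-injective ∘ g-injective , λ u v → g-adj _ _ ∘ f-adj u v

isLeft : ∀ {A B : Set} → A ⊎ B → Bool
isLeft = Sum.[ (λ _ → true) , (λ _ → false) ]

-- Translates the numerical test that defines the sides of `K` into the sum type, where the side is
-- the constructor.
join-left : ∀ {m n} (x : Fin m ⊎ Fin n) → (toℕ (join m n x) <ᵇ m) ≡ isLeft x
join-left {suc m}     (inj₁ zero)    = refl
join-left {suc m} {n} (inj₁ (suc i)) = join-left {m} {n} (inj₁ i)
join-left {zero}      (inj₂ j)       = refl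
join-left {suc m}     (inj₂ j)       = join-left {m} (inj₂ j)

-- Adjacency in `K` depends only on sides, and acting by `g` and `h` on the two summands keeps them.
-- The formula for `f` is returned as well, so that the images of the vertices can be located later.
K-mono : ∀ {m n m′ n′} {g : Fin m → Fin m′} {h : Fin n → Fin n′} →
  Injective _≡_ _≡_ g → Injective _≡_ _≡_ h →
  Σ[ (f , _) ∈ K m n ⊑ K m′ n′ ] (∀ u → f u ≡ join m′ n′ (Sum.map g h (splitAt m u)))
K-mono {m} {n} {m′} {n′} {g} {h} g-injective h-injective =
  (φ , φ-injective , λ u v → subst T (≡.sym (cong₂ _xor_ (φ-left u) (φ-left v)))) , (λ _ → refl)
  where
  φ : Fin (m + n) → Fin (m′ + n′)
  φ u = join m′ n′ (Sum.map g h (splitAt m u))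

  map-injective : Injective _≡_ _≡_ (Sum.map g h)
  map-injective {inj₁ _} {inj₁ _} eq = cong inj₁ (g-injective (inj₁-injective eq))
  map-injective {inj₂ _} {inj₂ _} eq = cong inj₂ (h-injective (inj₂-injective eq))

  φ-injective : Injective _≡_ _≡_ φ
  φ-injective {u} {v} eq =
    trans (≡.sym (join-splitAt m n u)) (trans (cong (join m n) (map-injective {splitAt m u} {splitAt m v}
      (trans (≡.sym (splitAt-join m′ n′ _)) (trans (cong (splitAt m′) eq) (splitAt-join m′ n′ _)))))
      (join-splitAt m n v))

  isLeft-map : ∀ x → isLeft (Sum.map g h x) ≡ isLeft x
  isLeft-map (inj₁ _) = refl
  isLeft-map (inj₂ _) = refl

  φ-left : ∀ u → (toℕ (φ u) <ᵇ m′) ≡ (toℕ u <ᵇ m)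
  φ-left u = trans (join-left (Sum.map g h (splitAt m u))) (trans (isLeft-map (splitAt m u))
    (trans (≡.sym (join-left (splitAt m u))) (cong (λ w → toℕ w <ᵇ m) (join-splitAt m n u))))

K-in-two-parts : ∀ G {N s} t (P : Partition (order G) N) → N * t < s → K s s ⊑ G →
  Σ[ i ∈ (Fin 2 → Fin N) ] K t t ⊑ (G [ ⋃ᵖ P i ])
K-in-two-parts G {N} {s} t P Nt<s KG@(f , _) =
  -- Each vertex of the copy is coloured by the part that covers its image, one side at a time. The
  -- parts `a` and `b` may coincide: a decomposition allows repeated indices.
  let a , g , g-injective , g-part = pigeonhole-many t (λ u → proj₁ (cover P (f (u ↑ˡ s)))) Nt<s
      b , h , h-injective , h-part = pigeonhole-many t (λ u → proj₁ (cover P (f (s ↑ʳ u)))) Nt<s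
      KK , KK-def = K-mono g-injective h-injective
      i = Vec.lookup (a ∷ b ∷ [])
      sides : ∀ x → f (join s s (Sum.map g h x)) ∈ ⋃ᵖ P i
      sides = λ where
        (inj₁ j) → ∈-⋃-tabulate⁺ (part P ∘ i) zero
          (subst (λ k → f (g j ↑ˡ s) ∈ part P k) (g-part j) (proj₂ (cover P _)))
        (inj₂ j) → ∈-⋃-tabulate⁺ (part P ∘ i) (suc zero)
          (subst (λ k → f (s ↑ʳ h j) ∈ part P k) (h-part j) (proj₂ (cover P _)))
  in i , ⊑-induced (K t t) G (⋃ᵖ P i) (⊑-trans (K t t) (K s s) G KK KG)
           λ u → subst (λ w → f w ∈ ⋃ᵖ P i) (≡.sym (KK-def u)) (sides (splitAt t u))

-- If `s ≤ F * t`, squaring gives `s * s ≤ s * (2 * (t * t))`; cancelling the positive `s`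
-- contradicts `2 * (t * t) < s`.
product-bound : ∀ F s t → F ^ 2 ≤ s + s → 2 * (t * t) < s → F * t < s
product-bound F s@(suc _) t F²≤2s 2t²<s = ≰⇒> λ s≤Ft → <⇒≱ 2t²<s (*-cancelˡ-≤ s (begin
  s * s               ≤⟨ *-mono-≤ s≤Ft s≤Ft ⟩
  F * t * (F * t)     ≡⟨ square F t ⟩
  F ^ 2 * (t * t)     ≤⟨ *-monoˡ-≤ (t * t) F²≤2s ⟩
  (s + s) * (t * t)   ≡⟨ double s t ⟩
  s * (2 * (t * t))   ∎))
  where
  open ≤-Reasoning
  -- F * (F * 1) is F ^ 2 unfolded, as solve-∀ fails on literal exponents.
  square : ∀ F t → F * t * (F * t) ≡ F * (F * 1) * (t * t)
  square = solve-∀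
  double : ∀ s t → (s + s) * (t * t) ≡ s * (2 * (t * t))
  double = solve-∀

trivialPartition : ∀ n → ∃[ N ] N ≤ 1 × Partition n N
-- Parts are nonempty, so the graph without vertices has no part at all.
trivialPartition zero = 0 , z≤n , record
  { part = λ () ; nonempty = λ () ; disjoint = λ { {()} } ; cover = λ () }
trivialPartition (suc n) = 1 , ≤-refl , record
  { part     = λ _ → ⊤
  ; nonempty = λ _ → zero , ∈⊤
  ; disjoint = λ { {zero} {zero} i≢j → contradiction refl i≢j }
  ; cover    = λ _ → zero , ∈⊤
  }

-- A single part suffices, with `𝒞` as its own target class: it contains all induced subgraphs of
-- its members.
Π⊆Π* : ∀ {ℓ} (Π : HereditaryClassProperty ℓ) {𝒞} → 𝒞 ∈ᵖ Π → 𝒞 ∈ᵖ Π *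
Π⊆Π* Π {𝒞} 𝒞∈Π p = (λ _ → 1) , (λ _ → ≤-refl) , subpolynomial , 𝒞 , 𝒞∈Π , λ G G∈𝒞 →
  let N , N≤1 , P = trivialPartition (order G)
  in  N , N≤1 , P , λ i → HereditaryClass.induced-closed 𝒞 (⋃ᵖ P i) G∈𝒞
  where
  subpolynomial : Subpolynomial (λ _ → 1)
  -- The threshold is 1 because `1 ^ k ≤ n` fails at `n = 0`.
  subpolynomial k = 1 , λ n 1≤n → ≤-refl , ≤-trans (≤-reflexive (^-zeroˡ k)) 1≤n

weaklySparse*⊆weaklySparse : ∀ {𝒞} → 𝒞 ∈ᵖ weaklySparse * → 𝒞 ∈ᵖ weaklySparse
weaklySparse*⊆weaklySparse {𝒞} 𝒞∈Σ* with 𝒞∈Σ* 2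
... | f , f-mono , f-sub , 𝒟 , (t , 𝒟-free) , decompose = s , free
  where
  n₀ = proj₁ (f-sub 2)
  -- Large enough for both `2 * (t * t) < s` and `n₀ ≤ s + s`, and chosen before any `G` is given.
  s  = suc (2 * (t * t) + n₀)

  n₀≤2s : n₀ ≤ s + s
  n₀≤2s = ≤-trans (m≤n+m n₀ (suc (2 * (t * t)))) (m≤m+n s s)

  f[2s]t<s : f (s + s) * t < s
  f[2s]t<s = product-bound (f (s + s)) s t (proj₂ (proj₂ (f-sub 2) (s + s) n₀≤2s)) (s≤s (m≤m+n _ n₀))

  free : ∀ G → G ∈ᶜ 𝒞 → ¬ (K s s ⊑ G)
  free G G∈𝒞 KG@(e , _) =
    -- The order of `G` is unbounded, so `f (order G)` would give no uniform bound on the number of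
    -- parts. The subgraph on `S` is still in `𝒞`, and `f-mono` bounds its number of parts by
    -- `f (s + s)`.
    let S = image e
        N , N≤f , P , P∈𝒟 = decompose (G [ S ]) (HereditaryClass.induced-closed 𝒞 S G∈𝒞)
        N≤f[2s] = ≤-trans N≤f (f-mono (∣image∣≤ e))
        i , KD = K-in-two-parts (G [ S ]) t P (≤-<-trans (*-monoˡ-≤ t N≤f[2s]) f[2s]t<s)
                   (⊑-induced (K s s) G S KG (∈-image e))
    in  𝒟-free _ (P∈𝒟 i) KD

mainTheorem5 : IsDecompositionHorizon weaklySparse
mainTheorem5 𝒞 = mk⇔ (weaklySparse*⊆weaklySparse {𝒞}) (Π⊆Π* weaklySparse {𝒞})
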